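{- Let $X$ be a normal modal logic between $K$ and $T$, i.e. $K\subseteq X\subseteq T$. The following conditions are equivalent, given any $\Gamma\cup\{\varphi\}\subseteq\mathcal{L}(\blacktriangle)$: (1) $\Gamma\vdash_{\mathbf{K}^\blacktriangle}\varphi$ (there is a derivation from $\Gamma$ to $\varphi$ in $\mathbf{K}^\blacktriangle$); (2) $\Gamma\vDash\varphi$ ($\Gamma$ entails $\varphi$ over the class of all frames); (3) $\Gamma\vDash_X\varphi$ ($\Gamma$ entails $\varphi$ over the class of frames for $X$); (4) $\Gamma\vDash_T\varphi$ ($\Gamma$ entails $\varphi$ over the class of reflexive frames).
   Context: Let $\mathbf{P}$ be a set of propositional variables. $\mathcal{L}(\blacktriangle)$-formulas: $\varphi::=\top\mid p\mid\neg\varphi\mid(\varphi\land\varphi)\mid\blacktriangle\varphi$ with $p\in\mathbf{P}$; other Boolean connectives are defined as usual. A frame is $\langle S,R\rangle$ with $S$ nonempty and $R\subseteq S\times S$; a model on it adds a valuation $V:\mathbf{P}\to\mathcal{P}(S)$. Truth: $\top$, variables, $\neg$, $\land$ as usual; $\mathcal{M},s\vDash\blacktriangle\varphi$ iff (if $\mathcal{M},s\vDash\varphi$ then $\mathcal{M},t\vDash\varphi$ for all $t$ with $sRt$) and (if $\mathcal{M},s\nvDash\varphi$ then $\mathcal{M},t\nvDash\varphi$ for all $t$ with $sRt$). $\Gamma$ entails $\varphi$ over a class of frames if $\Gamma\cup\{\neg\varphi\}$ is not satisfied at any point of any model based on a frame in the class. $K$ is the least normal modal logic in the language $\mathcal{L}(\Box)$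 (built from $\mathbf{P}$ with $\top,\neg,\land,\Box$, with standard Kripke semantics), and $T$ is the least normal modal logic containing $\Box p\to p$. A frame for $X$ is a frame on which every formula of $X$ is valid. The axiomatic system $\mathbf{K}^\blacktriangle$ consists of all propositional tautologies, uniform substitution, modus ponens, plus the axioms (with $p,q$ propositional variables) $\blacktriangle\top$; $\ \blacktriangle\neg p\leftrightarrow\blacktriangle p$; $\ \blacktriangle p\land\blacktriangle q\to\blacktriangle(p\land q)$; and the inference rule R: from $\varphi\to\psi$ infer $\blacktriangle\varphi\land\varphi\to\blacktriangle\psi$. A derivation from $\Gamma$ to $\varphi$ in $\mathbf{K}^\blacktriangle$, notation $\Gamma\vdash_{\mathbf{K}^\blacktriangle}\varphi$, is a finite sequence of $\mathcal{L}(\blacktriangle)$-formulas (ending in $\varphi$) in which each formula is either an instantiation of an axiom, or an element of $\Gamma$, or the result of applying an inference rule to prior formulas in the sequence.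
   Formalization: In derivations from Γ, uniform substitution and rule R are applied only to theorems (formulas derivable from no premises); if they applied to premises, {p} would derive every q and {p→q} would derive ▲p∧p→▲q, which is not entailed. -}

module Defs where

open import Data.Bool.Base using (Bool; true; not) renaming (_∧_ to _and_)
open import Data.Product.Base using (Σ-syntax; _×_)
open import Data.Unit.Base using () renaming (⊤ to Unit)
open import Induction.WellFounded using (WellFounded)
open import Level using (0ℓ; suc; _⊔_)
open import Relation.Binary.Core using (Rel)
open import Relation.Binary.Definitions using (Reflexive)
open import Relation.Binary.PropositionalEquality.Core using (_≡_)
open import Relation.Binary.Structures using (IsStrictTotalOrder)
open import Relation.Nullary.Negation.Core using (¬_)
open import Relation.Unary using (Pred; _∈_; _∪_; ｛_｝; ∅; U)

infix  9 ~_ □_ ▲_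
infixr 7 _∧_
infix  4 _⊢_

-- Zermelo's form of the axiom of choice. Choice for Σ-types, already provable,
-- does not serve: its choice functions need not respect extensional equality.
WellOrdering : Set₁
WellOrdering = (A : Set) →
  Σ[ _<_ ∈ Rel A 0ℓ ] (IsStrictTotalOrder _≡_ _<_ × WellFounded _<_)

-- 𝓛(□) and 𝓛(▲) differ only in the name of their unary modality, so they
-- are two instances of one datatype, told apart by a phantom parameter.
data Modality : Set where
  necessity noncontingency : Modality

data Formula (m : Modality) (P : Set) : Set where
  ⊤    : Formula m P
  var  : P → Formula m P
  ~_   : Formula m P → Formula m P
  _∧_  : Formula m P → Formula m P → Formula m P
  mod  : Formula m P → Formula m P

𝓛□ 𝓛▲ : Set → Set
𝓛□ = Formula necessity
𝓛▲ = Formula noncontingency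

□_ : ∀ {P} → 𝓛□ P → 𝓛□ P
□_ = mod

▲_ : ∀ {P} → 𝓛▲ P → 𝓛▲ P
▲_ = mod

module _ {m : Modality} {P : Set} where

  infixr 6 _⇒_
  infix  5 _⇿_

  _⇒_ _⇿_ : Formula m P → Formula m P → Formula m P
  φ ⇒ ψ = ~ (φ ∧ ~ ψ)
  φ ⇿ ψ = (φ ⇒ ψ) ∧ (ψ ⇒ φ)

  substitute : (P → Formula m P) → Formula m P → Formula m P
  substitute σ ⊤       = ⊤
  substitute σ (var p) = σ p
  substitute σ (~ φ)   = ~ substitute σ φ
  substitute σ (φ ∧ ψ) = substitute σ φ ∧ substitute σ ψ
  substitute σ (mod φ) = mod (substitute σ φ)

  -- Variables and modal formulas are the propositional atoms.
  truthValue : (P → Bool) → (Formula m P → Bool) → Formula m P → Bool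
  truthValue v w ⊤       = true
  truthValue v w (var p) = v p
  truthValue v w (~ φ)   = not (truthValue v w φ)
  truthValue v w (φ ∧ ψ) = truthValue v w φ and truthValue v w ψ
  truthValue v w (mod φ) = w φ

  Tautology : Formula m P → Set
  Tautology φ = ∀ v w → truthValue v w φ ≡ true

record Frame : Set₁ where
  field
    World    : Set
    _R_      : World → World → Set
    nonempty : World

record Model (P : Set) : Set₁ where
  field
    frame     : Frame
    valuation : P → Pred (Frame.World frame) 0ℓ
  open Frame frame public

module _ {P : Set} where

  infix 4 _,_⊨▲_ _,_⊨□_

  _,_⊨▲_ : (M : Model P) → Model.World M → 𝓛▲ P → Set
  M , s ⊨▲ ⊤     = Unit
  M , s ⊨▲ var p = s ∈ Model.valuation M p
  M , s ⊨▲ ~ φ   = ¬ (M , s ⊨▲ φ)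
  M , s ⊨▲ φ ∧ ψ = (M , s ⊨▲ φ) × (M , s ⊨▲ ψ)
  M , s ⊨▲ mod φ =
      (M , s ⊨▲ φ → ∀ t → s R t → M , t ⊨▲ φ)
    × (¬ (M , s ⊨▲ φ) → ∀ t → s R t → ¬ (M , t ⊨▲ φ))
    where open Model M

  _,_⊨□_ : (M : Model P) → Model.World M → 𝓛□ P → Set
  M , s ⊨□ ⊤     = Unit
  M , s ⊨□ var p = s ∈ Model.valuation M p
  M , s ⊨□ ~ φ   = ¬ (M , s ⊨□ φ)
  M , s ⊨□ φ ∧ ψ = (M , s ⊨□ φ) × (M , s ⊨□ ψ)
  M , s ⊨□ mod φ = ∀ t → s R t → M , t ⊨□ φ
    where open Model M

  Entails : ∀ {ℓ} → Pred Frame ℓ → Pred (𝓛▲ P) 0ℓ → 𝓛▲ P → Set (suc 0ℓ ⊔ ℓ)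
  Entails C Γ φ = ∀ (M : Model P) → Model.frame M ∈ C →
    ∀ s → ¬ (∀ ψ → ψ ∈ Γ ∪ ｛ ~ φ ｝ → M , s ⊨▲ ψ)

  Valid : Frame → Pred (𝓛□ P) 0ℓ → Set₁
  Valid F X = ∀ φ → φ ∈ X → ∀ (V : P → Pred (Frame.World F) 0ℓ) s →
    record { frame = F ; valuation = V } , s ⊨□ φ

AllFrames : Pred Frame 0ℓ
AllFrames = U

FramesFor : ∀ {P} → Pred (𝓛□ P) 0ℓ → Pred Frame (suc 0ℓ)
FramesFor X F = Valid F X

ReflexiveFrames : Pred Frame 0ℓ
ReflexiveFrames F = Reflexive (Frame._R_ F)

record IsNormal {P : Set} (X : Pred (𝓛□ P) 0ℓ) : Set where
  field
    tautology     : ∀ {φ} → Tautology φ → φ ∈ X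
    distribution  : ∀ {φ ψ} → □ (φ ⇒ ψ) ⇒ □ φ ⇒ □ ψ ∈ X
    modusPonens   : ∀ {φ ψ} → φ ⇒ ψ ∈ X → φ ∈ X → ψ ∈ X
    substitution  : ∀ {φ} σ → φ ∈ X → substitute σ φ ∈ X
    necessitation : ∀ {φ} → φ ∈ X → □ φ ∈ X

data LeastNormal {P : Set} (A : Pred (𝓛□ P) 0ℓ) : Pred (𝓛□ P) 0ℓ where
  axiom         : ∀ {φ} → φ ∈ A → φ ∈ LeastNormal A
  tautology     : ∀ {φ} → Tautology φ → φ ∈ LeastNormal A
  distribution  : ∀ {φ ψ} → □ (φ ⇒ ψ) ⇒ □ φ ⇒ □ ψ ∈ LeastNormal A
  modusPonens   : ∀ {φ ψ} → φ ⇒ ψ ∈ LeastNormal A → φ ∈ LeastNormal A →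
                  ψ ∈ LeastNormal A
  substitution  : ∀ {φ} σ → φ ∈ LeastNormal A → substitute σ φ ∈ LeastNormal A
  necessitation : ∀ {φ} → φ ∈ LeastNormal A → □ φ ∈ LeastNormal A

data AxiomT {P : Set} : Pred (𝓛□ P) 0ℓ where
  □p⇒p : ∀ p → □ var p ⇒ var p ∈ AxiomT

K T : (P : Set) → Pred (𝓛□ P) 0ℓ
K P = LeastNormal ∅
T P = LeastNormal AxiomT

-- Derivability in 𝐊▲. The axioms are given by all their instances. As usual
-- for derivability from premises with respect to entailment at a point,
-- substitution and the rule R apply to theorems only: otherwise p would
-- derive every formula, and p ⇒ q would derive ▲ p ∧ p ⇒ ▲ q.
data _⊢_ {P : Set} (Γ : Pred (𝓛▲ P) 0ℓ) : 𝓛▲ P → Set where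
  premise      : ∀ {φ} → φ ∈ Γ → Γ ⊢ φ
  tautology    : ∀ {φ} → Tautology φ → Γ ⊢ φ
  ▲⊤           : Γ ⊢ ▲ ⊤
  ▲~           : ∀ φ → Γ ⊢ ▲ ~ φ ⇿ ▲ φ
  ▲∧           : ∀ φ ψ → Γ ⊢ (▲ φ ∧ ▲ ψ) ⇒ ▲ (φ ∧ ψ)
  modusPonens  : ∀ {φ ψ} → Γ ⊢ φ ⇒ ψ → Γ ⊢ φ → Γ ⊢ ψ
  substitution : ∀ {φ} σ → ∅ ⊢ φ → Γ ⊢ substitute σ φ
  ruleR        : ∀ {φ ψ} → ∅ ⊢ φ ⇒ ψ → Γ ⊢ (▲ φ ∧ φ) ⇒ ▲ ψ

{-# OPTIONS --safe #-}

-- Replacing a frame by its reflexive closure does not change the truth of ▲ φ,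
-- so nothing is lost by building a canonical model that is reflexive: its worlds
-- are the maximal consistent sets, and s R t holds when t contains the core
-- {φ | ▲ φ, φ ∈ s} of s. By ▲⊤, ▲∧ and the rule R a core is closed under
-- derivability. Hence if φ ∈ s but ▲ φ ∉ s, the core of s does not derive φ and s
-- has a successor without φ; ▲~ reduces the case φ ∉ s to this one. Entailment
-- over the frames for X lies between entailment over all frames and over the
-- reflexive ones, because reflexive frames validate T ⊇ X.

module Submission where

open import Defs
open import Axiom.ExcludedMiddle using (ExcludedMiddle)
open import Data.Bool.Base using (Bool; true; false; not) renaming (_∧_ to _and_)
open import Data.Bool.Properties using (¬-not; not-¬; not-injective)
open import Data.Product.Base using (Σ-syntax; ∃-syntax; _×_; _,_; proj₁; proj₂)
open import Data.Product.Function.NonDependent.Propositional using (_×-⇔_)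
open import Data.Sum.Base using (_⊎_; inj₁; inj₂; [_,_]′)
open import Data.Unit.Base using (tt)
open import Function.Base using (id; _∘_)
open import Function.Bundles using (_⇔_; mk⇔; Equivalence)
open import Function.Construct.Identity using (⇔-id)
open import Function.Related.TypeIsomorphisms using (→-cong-⇔; ¬-cong-⇔)
open import Induction.WellFounded using (WellFounded; WfRec; module All; module FixPoint)
open import Level using (0ℓ)
open import Relation.Binary.Core using (Rel)
open import Relation.Binary.Definitions using (tri<; tri≈; tri>)
open import Relation.Binary.PropositionalEquality
  using (_≡_; refl; sym; trans; cong; cong₂; subst)
open import Relation.Binary.Structures using (IsStrictTotalOrder)
open import Relation.Nullary.Decidable using
  (_because_; does; proof; decidable-stable; dec-true; dec-false; does-⇔)
open import Relation.Nullary.Negation using (¬_; contradiction)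
open import Relation.Nullary.Reflects
  using (Reflects; ofʸ; ofⁿ; invert; ¬-reflects; _×-reflects_)
open import Relation.Unary using (Pred; _∈_; _⊆_; _∪_; ｛_｝; ∅)

open Equivalence using (to; from)

∀-cong-⇔ : {A : Set} {B C : A → Set} → (∀ x → B x ⇔ C x) → (∀ x → B x) ⇔ (∀ x → C x)
∀-cong-⇔ B⇔C = mk⇔ (λ f x → to (B⇔C x) (f x)) (λ f x → from (B⇔C x) (f x))

≡true-reflects : ∀ b → Reflects (b ≡ true) b
≡true-reflects true  = ofʸ refl
≡true-reflects false = ofⁿ λ ()

-- Tautologies and derivations

module _ {m : Modality} {P : Set} where

  ⇒-refl : (φ : Formula m P) → Tautology (φ ⇒ φ)
  ⇒-refl φ v w with truthValue v w φ
  ... | true  = refl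
  ... | false = refl

  ⇒-const : (φ ψ : Formula m P) → Tautology (φ ⇒ ψ ⇒ φ)
  ⇒-const φ ψ v w with truthValue v w φ | truthValue v w ψ
  ... | true  | true  = refl
  ... | true  | false = refl
  ... | false | _     = refl

  ⇒-ap : (φ ψ χ : Formula m P) → Tautology ((φ ⇒ ψ ⇒ χ) ⇒ (φ ⇒ ψ) ⇒ φ ⇒ χ)
  ⇒-ap φ ψ χ v w with truthValue v w φ | truthValue v w ψ | truthValue v w χ
  ... | true  | true  | true  = refl
  ... | true  | true  | false = refl
  ... | true  | false | true  = refl
  ... | true  | false | false = refl
  ... | false | _     | _     = refl

  ∧-intro : (φ ψ : Formula m P) → Tautology (φ ⇒ ψ ⇒ φ ∧ ψ)
  ∧-intro φ ψ v w with truthValue v w φ | truthValue v w ψ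
  ... | true  | true  = refl
  ... | true  | false = refl
  ... | false | _     = refl

  ∧-elimˡ : (φ ψ : Formula m P) → Tautology (φ ∧ ψ ⇒ φ)
  ∧-elimˡ φ ψ v w with truthValue v w φ | truthValue v w ψ
  ... | true  | true  = refl
  ... | true  | false = refl
  ... | false | _     = refl

  ∧-elimʳ : (φ ψ : Formula m P) → Tautology (φ ∧ ψ ⇒ ψ)
  ∧-elimʳ φ ψ v w with truthValue v w φ | truthValue v w ψ
  ... | true  | true  = refl
  ... | true  | false = refl
  ... | false | _     = refl

  ⇒-eval : (φ ψ : Formula m P) → Tautology ((φ ⇒ ψ) ∧ φ ⇒ ψ)
  ⇒-eval φ ψ v w with truthValue v w φ | truthValue v w ψ
  ... | true  | true  = refl
  ... | true  | false = refl
  ... | false | true  = refl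
  ... | false | false = refl

  ~-explosion : (φ : Formula m P) → Tautology (~ φ ⇒ φ ⇒ ~ ⊤)
  ~-explosion φ v w with truthValue v w φ
  ... | true  = refl
  ... | false = refl

  ~-intro : (φ : Formula m P) → Tautology ((φ ⇒ ~ ⊤) ⇒ ~ φ)
  ~-intro φ v w with truthValue v w φ
  ... | true  = refl
  ... | false = refl

  ~-reductio : (φ : Formula m P) → Tautology ((~ φ ⇒ ~ ⊤) ⇒ φ)
  ~-reductio φ v w with truthValue v w φ
  ... | true  = refl
  ... | false = refl

module _ {P : Set} where

  Consistent : Pred (𝓛▲ P) 0ℓ → Set
  Consistent Γ = ¬ (Γ ⊢ ~ ⊤)

  ⊢-weaken-∅ : ∀ {Γ : Pred (𝓛▲ P) 0ℓ} {φ} → ∅ ⊢ φ → Γ ⊢ φ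
  ⊢-weaken-∅ (tautology t)      = tautology t
  ⊢-weaken-∅ ▲⊤                 = ▲⊤
  ⊢-weaken-∅ (▲~ φ)             = ▲~ φ
  ⊢-weaken-∅ (▲∧ φ ψ)           = ▲∧ φ ψ
  ⊢-weaken-∅ (modusPonens d e)  = modusPonens (⊢-weaken-∅ d) (⊢-weaken-∅ e)
  ⊢-weaken-∅ (substitution σ d) = substitution σ d
  ⊢-weaken-∅ (ruleR d)          = ruleR d

  -- `substitution` and `ruleR` act on theorems and yield theorems, so whatever `Γ` derives arises
  -- from its members and from theorems by modus ponens alone.
  ⊢-elim : ∀ {Γ : Pred (𝓛▲ P) 0ℓ} (Q : 𝓛▲ P → Set) →
    (∀ {φ} → φ ∈ Γ → Q φ) →
    (∀ {φ} → ∅ ⊢ φ → Q φ) →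
    (∀ {φ ψ} → Q (φ ⇒ ψ) → Q φ → Q ψ) →
    ∀ {φ} → Γ ⊢ φ → Q φ
  ⊢-elim Q p t mp (premise φ∈Γ)      = p φ∈Γ
  ⊢-elim Q p t mp (tautology τ)      = t (tautology τ)
  ⊢-elim Q p t mp ▲⊤                 = t ▲⊤
  ⊢-elim Q p t mp (▲~ φ)             = t (▲~ φ)
  ⊢-elim Q p t mp (▲∧ φ ψ)           = t (▲∧ φ ψ)
  ⊢-elim Q p t mp (modusPonens d e)  = mp (⊢-elim Q p t mp d) (⊢-elim Q p t mp e)
  ⊢-elim Q p t mp (substitution σ d) = t (substitution σ d)
  ⊢-elim Q p t mp (ruleR d)          = t (ruleR d)

  ⊢-weaken : ∀ {Γ Δ : Pred (𝓛▲ P) 0ℓ} → Γ ⊆ Δ → ∀ {φ} → Γ ⊢ φ → Δ ⊢ φ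
  ⊢-weaken Γ⊆Δ = ⊢-elim _ (premise ∘ Γ⊆Δ) ⊢-weaken-∅ modusPonens

  deduction : ∀ {Γ : Pred (𝓛▲ P) 0ℓ} {φ ψ} → Γ ∪ ｛ φ ｝ ⊢ ψ → Γ ⊢ φ ⇒ ψ
  deduction {Γ} {φ} = ⊢-elim (λ ψ → Γ ⊢ φ ⇒ ψ)
    (λ { (inj₁ ψ∈Γ) → const (premise ψ∈Γ) ; (inj₂ refl) → tautology (⇒-refl φ) })
    (const ∘ ⊢-weaken-∅)
    (λ {ψ} {χ} d e → modusPonens (modusPonens (tautology (⇒-ap φ ψ χ)) d) e)
    where
    const : ∀ {ψ} → Γ ⊢ ψ → Γ ⊢ φ ⇒ ψ
    const {ψ} = modusPonens (tautology (⇒-const ψ φ))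

  ⊢-~ : ∀ {Γ : Pred (𝓛▲ P) 0ℓ} {φ} → Γ ∪ ｛ φ ｝ ⊢ ~ ⊤ → Γ ⊢ ~ φ
  ⊢-~ {φ = φ} d = modusPonens (tautology (~-intro φ)) (deduction d)

  ⊢-contradiction : ∀ {Γ : Pred (𝓛▲ P) 0ℓ} {φ} → Γ ⊢ ~ φ → Γ ⊢ φ → Γ ⊢ ~ ⊤
  ⊢-contradiction {φ = φ} d e =
    modusPonens (modusPonens (tautology (~-explosion φ)) d) e

-- Soundness

module Classical (em : ExcludedMiddle 0ℓ) where

  stable : {A : Set} → ¬ ¬ A → A
  stable = decidable-stable em

  ¬×¬⇒→ : {A B : Set} → ¬ (A × ¬ B) → A → B
  ¬×¬⇒→ h a = stable λ ¬b → h (a , ¬b)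

  →⇒¬×¬ : {A B : Set} → (A → B) → ¬ (A × ¬ B)
  →⇒¬×¬ f (a , ¬b) = ¬b (f a)

  module _ {m : Modality} {P : Set} (Sat : Formula m P → Set)
    (⊤-sat : Sat ⊤)
    (~-sat : ∀ φ → Sat (~ φ) ≡ (¬ Sat φ))
    (∧-sat : ∀ φ ψ → Sat (φ ∧ ψ) ≡ (Sat φ × Sat ψ)) where

    -- Excluded middle makes a Boolean valuation out of the truth of variables and modal formulas at
    -- a world. `Sat` is abstract so that `⊨▲` and `⊨□` share the argument.
    truthValue-reflects : ∀ φ → Reflects (Sat φ)
      (truthValue (λ p → does (em {Sat (var p)})) (λ ψ → does (em {Sat (mod ψ)})) φ)
    truthValue-reflects ⊤       = ofʸ ⊤-sat
    truthValue-reflects (var p) = proof em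
    truthValue-reflects (~ φ)   rewrite ~-sat φ = ¬-reflects (truthValue-reflects φ)
    truthValue-reflects (φ ∧ ψ) rewrite ∧-sat φ ψ =
      truthValue-reflects φ ×-reflects truthValue-reflects ψ
    truthValue-reflects (mod φ) = proof em

    tautology-sat : ∀ φ → Tautology φ → Sat φ
    tautology-sat φ τ = invert (subst (Reflects _) (τ _ _) (truthValue-reflects φ))

  module _ {P : Set} where

    substitute-⊨▲ : ∀ (M : Model P) σ φ s → let open Model M in
      record { frame = frame ; valuation = λ p t → M , t ⊨▲ σ p } , s ⊨▲ φ
        ⇔ M , s ⊨▲ substitute σ φ
    substitute-⊨▲ M σ ⊤       s = ⇔-id _
    substitute-⊨▲ M σ (var p) s = ⇔-id _
    substitute-⊨▲ M σ (~ φ)   s = ¬-cong-⇔ (substitute-⊨▲ M σ φ s)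
    substitute-⊨▲ M σ (φ ∧ ψ) s = substitute-⊨▲ M σ φ s ×-⇔ substitute-⊨▲ M σ ψ s
    substitute-⊨▲ M σ (mod φ) s =
      →-cong-⇔ (IH s) (∀-cong-⇔ λ t → →-cong-⇔ (⇔-id _) (IH t)) ×-⇔
      →-cong-⇔ (¬-cong-⇔ (IH s)) (∀-cong-⇔ λ t → →-cong-⇔ (⇔-id _) (¬-cong-⇔ (IH t)))
      where IH = substitute-⊨▲ M σ φ

    substitute-⊨□ : ∀ (M : Model P) σ φ s → let open Model M in
      record { frame = frame ; valuation = λ p t → M , t ⊨□ σ p } , s ⊨□ φ
        ⇔ M , s ⊨□ substitute σ φ
    substitute-⊨□ M σ ⊤       s = ⇔-id _
    substitute-⊨□ M σ (var p) s = ⇔-id _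
    substitute-⊨□ M σ (~ φ)   s = ¬-cong-⇔ (substitute-⊨□ M σ φ s)
    substitute-⊨□ M σ (φ ∧ ψ) s = substitute-⊨□ M σ φ s ×-⇔ substitute-⊨□ M σ ψ s
    substitute-⊨□ M σ (mod φ) s =
      ∀-cong-⇔ λ t → →-cong-⇔ (⇔-id _) (substitute-⊨□ M σ φ t)

    -- `M` and `s` vary in the induction: `substitution` needs its premise under another valuation,
    -- `ruleR` needs its premise at successors.
    ⊢-sound : ∀ {Γ : Pred (𝓛▲ P) 0ℓ} {φ} → Γ ⊢ φ →
      ∀ M s → (∀ ψ → ψ ∈ Γ → M , s ⊨▲ ψ) → M , s ⊨▲ φ
    ⊢-sound (premise φ∈Γ) M s ⊨Γ = ⊨Γ _ φ∈Γ
    ⊢-sound {φ = φ} (tautology τ) M s _ =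
      tautology-sat (M , s ⊨▲_) tt (λ _ → refl) (λ _ _ → refl) φ τ
    ⊢-sound ▲⊤ M s _ = (λ _ _ _ → tt) , λ ¬tt _ _ _ → ¬tt tt
    -- Negation swaps the two clauses of `▲`, up to a double negation.
    ⊢-sound (▲~ φ) M s _ =
      →⇒¬×¬ (λ (f , g) → (λ a t sRt → stable (g (λ ¬a → ¬a a) t sRt)) , f) ,
      →⇒¬×¬ (λ (f , g) → g , λ ¬¬a t sRt ¬b → ¬b (f (stable ¬¬a) t sRt))
    ⊢-sound (▲∧ φ ψ) M s _ = →⇒¬×¬ λ ((f , g) , (f′ , g′)) →
      (λ (a , b) t sRt → f a t sRt , f′ b t sRt) ,
      λ ¬ab t sRt (a′ , b′) →
        ¬ab (stable (λ ¬a → g ¬a t sRt a′) , stable (λ ¬b → g′ ¬b t sRt b′))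
    ⊢-sound (modusPonens d e) M s ⊨Γ = ¬×¬⇒→ (⊢-sound d M s ⊨Γ) (⊢-sound e M s ⊨Γ)
    ⊢-sound (substitution {φ} σ d) M s _ =
      to (substitute-⊨▲ M σ φ s) (⊢-sound d _ s λ _ ())
    -- Since `φ` holds at `s`, so does `ψ`, and the second clause of `▲ ψ` is vacuous.
    ⊢-sound (ruleR {φ} {ψ} d) M s _ = →⇒¬×¬ λ ((f , _) , a) →
      (λ _ t sRt → imp t (f a t sRt)) , λ ¬b → contradiction (imp s a) ¬b
      where
      imp : ∀ t → M , t ⊨▲ φ → M , t ⊨▲ ψ
      imp t = ¬×¬⇒→ (⊢-sound d M t λ _ ())

    ⊢⇒Entails : ∀ {ℓ} (C : Pred Frame ℓ) {Γ φ} → Γ ⊢ φ → Entails C Γ φ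
    ⊢⇒Entails C d M _ s ⊨Γ,~φ =
      ⊨Γ,~φ _ (inj₂ refl) (⊢-sound d M s λ ψ ψ∈Γ → ⊨Γ,~φ ψ (inj₁ ψ∈Γ))

    T-valid : ∀ {F} → F ∈ ReflexiveFrames → Valid F (T P)
    T-valid R-refl _ (axiom (□p⇒p p)) V s = →⇒¬×¬ λ h → h s R-refl
    T-valid R-refl φ (tautology τ) V s =
      tautology-sat (_ , s ⊨□_) tt (λ _ → refl) (λ _ _ → refl) φ τ
    T-valid R-refl _ distribution V s =
      →⇒¬×¬ λ f → →⇒¬×¬ λ g t sRt → ¬×¬⇒→ (f t sRt) (g t sRt)
    T-valid R-refl _ (modusPonens d e) V s =
      ¬×¬⇒→ (T-valid R-refl _ d V s) (T-valid R-refl _ e V s)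
    T-valid R-refl _ (substitution {φ} σ d) V s =
      to (substitute-⊨□ _ σ φ s) (T-valid R-refl φ d _ s)
    T-valid R-refl _ (necessitation d) V s t _ = T-valid R-refl _ d V t

-- Completeness

-- Sets of formulas are Bool-valued here, because Pred (𝓛▲ P) 0ℓ is too large to
-- be a type of worlds.
⟦_⟧ : {A : Set} → (A → Bool) → Pred A 0ℓ
⟦ w ⟧ x = w x ≡ true

-- Maximality is phrased as refutability of every missing formula, which by the deduction theorem
-- says that none can be added consistently.
record MaximalConsistent {P : Set} (w : 𝓛▲ P → Bool) : Set where
  field
    consistent : Consistent ⟦ w ⟧
    maximal    : ∀ φ → w φ ≡ false → ⟦ w ⟧ ⊢ ~ φ

  closed : ∀ {φ} → ⟦ w ⟧ ⊢ φ → φ ∈ ⟦ w ⟧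
  closed {φ} d = ¬-not λ φ∉w → consistent (⊢-contradiction (maximal φ φ∉w) d)

  ~-member : ∀ φ → w (~ φ) ≡ not (w φ)
  ~-member φ with w φ in eq
  ... | true  = ¬-not λ ~φ∈w → consistent (⊢-contradiction (premise ~φ∈w) (premise eq))
  ... | false = closed (maximal φ eq)

  ∧-member : ∀ φ ψ → w (φ ∧ ψ) ≡ w φ and w ψ
  ∧-member φ ψ with w φ in φ-eq | w ψ in ψ-eq
  ... | true  | true  = closed
    (modusPonens (modusPonens (tautology (∧-intro φ ψ)) (premise φ-eq)) (premise ψ-eq))
  ... | true  | false = ¬-not λ φ∧ψ∈w → not-¬ ψ-eq
    (closed (modusPonens (tautology (∧-elimʳ φ ψ)) (premise φ∧ψ∈w)))
  ... | false | _     = ¬-not λ φ∧ψ∈w → not-¬ φ-eq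
    (closed (modusPonens (tautology (∧-elimˡ φ ψ)) (premise φ∧ψ∈w)))

  -- On reflexive frames `▲ φ ∧ φ` means what `□ φ` does, so this is the counterpart of the set of
  -- `φ` with `□ φ` in `w` from the usual canonical model.
  core : Pred (𝓛▲ P) 0ℓ
  core φ = ▲ φ ∈ ⟦ w ⟧ × φ ∈ ⟦ w ⟧

  ▲-monotone : ∀ {φ ψ} → ∅ ⊢ φ ⇒ ψ → φ ∈ core → ψ ∈ core
  ▲-monotone {φ} {ψ} d (▲φ∈w , φ∈w) =
    closed (modusPonens (ruleR d) (premise (trans (∧-member (▲ φ) φ) (cong₂ _and_ ▲φ∈w φ∈w)))) ,
    closed (modusPonens (⊢-weaken-∅ d) (premise φ∈w))

  core-closed : ∀ {φ} → core ⊢ φ → φ ∈ core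
  core-closed = ⊢-elim core id
    -- A theorem is implied by `⊤`, which lies in the core by `▲⊤`.
    (λ {φ} d → ▲-monotone (modusPonens (tautology (⇒-const φ ⊤)) d)
      (closed ▲⊤ , closed (tautology λ _ _ → refl)))
    -- The rule R has a single antecedent, so `▲∧` first merges the two premises of modus ponens
    -- into one conjunction.
    (λ {φ} {ψ} (▲φ⇒ψ , φ⇒ψ) (▲φ , φ∈w) → ▲-monotone (tautology (⇒-eval φ ψ))
      ( closed (modusPonens (▲∧ (φ ⇒ ψ) φ)
          (premise (trans (∧-member (▲ (φ ⇒ ψ)) (▲ φ)) (cong₂ _and_ ▲φ⇒ψ ▲φ))))
      , trans (∧-member (φ ⇒ ψ) φ) (cong₂ _and_ φ⇒ψ φ∈w)))

  ▲~⇒▲ : ∀ φ → ▲ ~ φ ∈ ⟦ w ⟧ → ▲ φ ∈ ⟦ w ⟧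
  ▲~⇒▲ φ ▲~φ∈w = closed (modusPonens
    (modusPonens (tautology (∧-elimˡ (▲ ~ φ ⇒ ▲ φ) (▲ φ ⇒ ▲ ~ φ))) (▲~ φ))
    (premise ▲~φ∈w))

  ▲⇒▲~ : ∀ φ → ▲ φ ∈ ⟦ w ⟧ → ▲ ~ φ ∈ ⟦ w ⟧
  ▲⇒▲~ φ ▲φ∈w = closed (modusPonens
    (modusPonens (tautology (∧-elimʳ (▲ ~ φ ⇒ ▲ φ) (▲ φ ⇒ ▲ ~ φ))) (▲~ φ))
    (premise ▲φ∈w))

module _ (em : ExcludedMiddle 0ℓ) (wo : WellOrdering) {P : Set} where

  open Classical em using (stable)

  -- Run through all formulas along the well-ordering, keeping φ whenever it is
  -- consistent with Γ and the formulas kept before it.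
  module Lindenbaum (Γ : Pred (𝓛▲ P) 0ℓ) where

    private
      _<_ : Rel (𝓛▲ P) 0ℓ
      _<_ = proj₁ (wo (𝓛▲ P))

      <-wf : WellFounded _<_
      <-wf = proj₂ (proj₂ (wo (𝓛▲ P)))

      open IsStrictTotalOrder (proj₁ (proj₂ (wo (𝓛▲ P)))) using (compare)
        renaming (trans to <-trans)

      extend : ∀ φ → WfRec _<_ (λ _ → Bool) φ → Pred (𝓛▲ P) 0ℓ
      extend φ kept = (Γ ∪ λ ψ → Σ[ ψ<φ ∈ ψ < φ ] kept ψ<φ ≡ true) ∪ ｛ φ ｝

      extend-⊆ : ∀ φ {kept kept′ : WfRec _<_ (λ _ → Bool) φ} →
        (∀ {ψ} (ψ<φ : ψ < φ) → kept ψ<φ ≡ kept′ ψ<φ) → extend φ kept ⊆ extend φ kept′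
      extend-⊆ φ eq (inj₁ (inj₁ ψ∈Γ))        = inj₁ (inj₁ ψ∈Γ)
      extend-⊆ φ eq (inj₁ (inj₂ (ψ<φ , kψ))) = inj₁ (inj₂ (ψ<φ , trans (sym (eq ψ<φ)) kψ))
      extend-⊆ φ eq (inj₂ φ≡ψ)               = inj₂ φ≡ψ

      keep : ∀ φ → WfRec _<_ (λ _ → Bool) φ → Bool
      keep φ kept = does (em {Consistent (extend φ kept)})

      -- Unfolding the well-founded recursion requires a step that respects pointwise equality.
      -- Pointwise equal choices give mutually included sets, hence the same answer about
      -- consistency.
      keep-ext : ∀ φ {kept kept′ : WfRec _<_ (λ _ → Bool) φ} →
        (∀ {ψ} (ψ<φ : ψ < φ) → kept ψ<φ ≡ kept′ ψ<φ) → keep φ kept ≡ keep φ kept′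
      keep-ext φ eq = does-⇔
        (mk⇔ (λ c → c ∘ ⊢-weaken (extend-⊆ φ (sym ∘ eq))) (λ c → c ∘ ⊢-weaken (extend-⊆ φ eq)))
        em em

    completion : 𝓛▲ P → Bool
    completion = All.wfRec <-wf 0ℓ (λ _ → Bool) keep

    private
      stage : 𝓛▲ P → Pred (𝓛▲ P) 0ℓ
      stage φ = extend φ (λ {ψ} _ → completion ψ)

      completion-reflects : ∀ φ → Reflects (Consistent (stage φ)) (completion φ)
      completion-reflects φ = subst (Reflects _)
        (sym (FixPoint.unfold-wfRec <-wf (λ _ → Bool) keep keep-ext)) (proof em)

      stage-consistent : ∀ {φ} → φ ∈ ⟦ completion ⟧ → Consistent (stage φ)
      stage-consistent {φ} φ∈ = invert (subst (Reflects _) φ∈ (completion-reflects φ))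

      stage-⊆ : ∀ φ → stage φ ⊆ (Γ ∪ ⟦ completion ⟧) ∪ ｛ φ ｝
      stage-⊆ φ (inj₁ (inj₁ ψ∈Γ))      = inj₁ (inj₁ ψ∈Γ)
      stage-⊆ φ (inj₁ (inj₂ (_ , ψ∈))) = inj₁ (inj₂ ψ∈)
      stage-⊆ φ (inj₂ φ≡ψ)             = inj₂ φ≡ψ

      stage-mono : ∀ {φ ψ} → φ ∈ ⟦ completion ⟧ → φ < ψ → stage φ ⊆ stage ψ
      stage-mono φ∈ φ<ψ (inj₁ (inj₁ χ∈Γ))        = inj₁ (inj₁ χ∈Γ)
      stage-mono φ∈ φ<ψ (inj₁ (inj₂ (χ<φ , χ∈))) = inj₁ (inj₂ (<-trans χ<φ φ<ψ , χ∈))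
      stage-mono φ∈ φ<ψ (inj₂ refl)              = inj₁ (inj₂ (φ<ψ , φ∈))

      -- A derivation uses finitely many kept formulas, and the stage of the last one contains them
      -- all. The first alternative covers derivations that use none.
      ⊢-compact : ∀ {χ} → Γ ∪ ⟦ completion ⟧ ⊢ χ →
        Γ ⊢ χ ⊎ (∃[ φ ] φ ∈ ⟦ completion ⟧ × stage φ ⊢ χ)
      ⊢-compact = ⊢-elim _
        [ inj₁ ∘ premise , (λ χ∈ → inj₂ (_ , χ∈ , premise (inj₂ refl))) ]′
        (inj₁ ∘ ⊢-weaken-∅)
        mp
        where
        mp : ∀ {χ ξ} →
          Γ ⊢ χ ⇒ ξ ⊎ (∃[ φ ] φ ∈ ⟦ completion ⟧ × stage φ ⊢ χ ⇒ ξ) →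
          Γ ⊢ χ ⊎ (∃[ φ ] φ ∈ ⟦ completion ⟧ × stage φ ⊢ χ) →
          Γ ⊢ ξ ⊎ (∃[ φ ] φ ∈ ⟦ completion ⟧ × stage φ ⊢ ξ)
        mp (inj₁ d) (inj₁ e) = inj₁ (modusPonens d e)
        mp (inj₁ d) (inj₂ (φ , φ∈ , e)) =
          inj₂ (φ , φ∈ , modusPonens (⊢-weaken (inj₁ ∘ inj₁) d) e)
        mp (inj₂ (φ , φ∈ , d)) (inj₁ e) =
          inj₂ (φ , φ∈ , modusPonens d (⊢-weaken (inj₁ ∘ inj₁) e))
        -- Stages of kept formulas grow along the ordering, so the later one carries both
        -- derivations.
        mp (inj₂ (φ , φ∈ , d)) (inj₂ (ψ , ψ∈ , e)) with compare φ ψ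
        ... | tri< φ<ψ _ _  = inj₂ (ψ , ψ∈ , modusPonens (⊢-weaken (stage-mono φ∈ φ<ψ) d) e)
        ... | tri≈ _ refl _ = inj₂ (ψ , ψ∈ , modusPonens d e)
        ... | tri> _ _ ψ<φ  = inj₂ (φ , φ∈ , modusPonens d (⊢-weaken (stage-mono ψ∈ ψ<φ) e))

      -- A formula is rejected only when its stage is inconsistent. `Γ` remains a separate set of
      -- premises until `Γ⊆completion` absorbs it.
      maximal : ∀ φ → completion φ ≡ false → Γ ∪ ⟦ completion ⟧ ⊢ ~ φ
      maximal φ φ∉ = ⊢-~ (⊢-weaken (stage-⊆ φ)
        (stable (invert (subst (Reflects _) φ∉ (completion-reflects φ)))))

    module _ (Γ-consistent : Consistent Γ) where

      private
        consistent : Consistent (Γ ∪ ⟦ completion ⟧)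
        consistent d with ⊢-compact d
        ... | inj₁ e            = Γ-consistent e
        ... | inj₂ (φ , φ∈ , e) = stage-consistent φ∈ e

      -- Members of `Γ` face the same test as all formulas; rejecting one would make it refutable
      -- alongside itself.
      Γ⊆completion : Γ ⊆ ⟦ completion ⟧
      Γ⊆completion {φ} φ∈Γ = ¬-not λ φ∉ →
        consistent (⊢-contradiction (maximal φ φ∉) (premise (inj₁ φ∈Γ)))

      completion-maximalConsistent : MaximalConsistent completion
      completion-maximalConsistent = record
        { consistent = consistent ∘ ⊢-weaken inj₂
        ; maximal    = λ φ φ∉ → ⊢-weaken [ Γ⊆completion , id ]′ (maximal φ φ∉)
        }

  -- The canonical model and the truth lemma

  CanonicalWorld : Set
  CanonicalWorld = Σ[ w ∈ (𝓛▲ P → Bool) ] MaximalConsistent w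

  member : CanonicalWorld → 𝓛▲ P → Bool
  member = proj₁

  lindenbaum : ∀ {Γ} → Consistent Γ → Σ[ s ∈ CanonicalWorld ] Γ ⊆ ⟦ member s ⟧
  lindenbaum {Γ} c = (completion , completion-maximalConsistent c) , Γ⊆completion c
    where open Lindenbaum Γ

  _⟶_ : CanonicalWorld → CanonicalWorld → Set
  (_ , s) ⟶ (t , _) = MaximalConsistent.core s ⊆ ⟦ t ⟧

  ⟶-refl : ∀ {s} → s ⟶ s
  ⟶-refl = proj₂

  -- By reductio the core stays consistent with `~ φ`, and any maximal consistent set extending both
  -- is a successor by definition of `⟶`.
  core-witness : ∀ (s : CanonicalWorld) φ →
    ¬ (MaximalConsistent.core (proj₂ s) ⊢ φ) → ∃[ t ] s ⟶ t × member t φ ≡ false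
  core-witness s φ ¬d with lindenbaum (λ d → ¬d
    (modusPonens (tautology (~-reductio φ)) (deduction d)))
  ... | t , ⊆t = t , (λ χ∈core → ⊆t (inj₁ χ∈core)) ,
    not-injective (trans (sym (MaximalConsistent.~-member (proj₂ t) φ)) (⊆t (inj₂ refl)))

  module _ (s₀ : CanonicalWorld) where

    canonicalModel : Model P
    canonicalModel = record
      { frame     = record { World = CanonicalWorld ; _R_ = _⟶_ ; nonempty = s₀ }
      ; valuation = λ p s → var p ∈ ⟦ member s ⟧
      }

    -- `Reflects` carries membership and non-membership together, as the two clauses of `▲` require.
    truth : ∀ φ s → Reflects (canonicalModel , s ⊨▲ φ) (member s φ)
    truth ⊤ (w , mc) = subst (Reflects _) (sym ⊤∈w) (ofʸ tt)
      where
      ⊤∈w : w ⊤ ≡ true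
      ⊤∈w = MaximalConsistent.closed mc (tautology λ _ _ → refl)
    truth (var p) s = ≡true-reflects (member s (var p))
    truth (~ φ) s = subst (Reflects _) (sym (~-member φ)) (¬-reflects (truth φ s))
      where open MaximalConsistent (proj₂ s)
    truth (φ ∧ ψ) s =
      subst (Reflects _) (sym (∧-member φ ψ)) (truth φ s ×-reflects truth ψ s)
      where open MaximalConsistent (proj₂ s)
    truth (mod φ) s with member s (▲ φ) in ▲φ-eq
    -- Whichever of `φ` and `~ φ` belongs to `s` lies in its core, hence in every successor.
    ... | true = ofʸ
      ( (λ a t s⟶t → invert (subst (Reflects _)
          (s⟶t (▲φ-eq , dec-true (_ because truth φ s) a)) (truth φ t)))
      , λ ¬a t s⟶t → invert (subst (Reflects _)
          (not-injective (trans (sym (MaximalConsistent.~-member (proj₂ t) φ))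
            (s⟶t (▲⇒▲~ φ ▲φ-eq ,
              trans (~-member φ) (cong not (dec-false (_ because truth φ s) ¬a))))))
          (truth φ t)) )
      where open MaximalConsistent (proj₂ s)
    ... | false = ofⁿ λ (f , g) → refute f g (member s φ) refl
      where
      open MaximalConsistent (proj₂ s)

      refute : (canonicalModel , s ⊨▲ φ → ∀ t → s ⟶ t → canonicalModel , t ⊨▲ φ) →
        (¬ canonicalModel , s ⊨▲ φ → ∀ t → s ⟶ t → ¬ canonicalModel , t ⊨▲ φ) →
        ∀ b → ¬ member s φ ≡ b
      -- If the core derived `φ`, it would contain `φ`, and `▲ φ` would be in `s`. So some successor
      -- lacks `φ`, against `f`.
      refute f g true φ∈s
        with t , s⟶t , φ∉t ← core-witness s φ
          (λ d → not-¬ ▲φ-eq (proj₁ (core-closed d))) =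
        invert (subst (Reflects _) φ∉t (truth φ t))
          (f (invert (subst (Reflects _) φ∈s (truth φ s))) t s⟶t)
      -- The same for `~ φ`, with `▲~` turning `▲ ~ φ` into `▲ φ`. The successor lacks `~ φ`, hence
      -- contains `φ`, against `g`.
      refute f g false φ∉s
        with t , s⟶t , ~φ∉t ← core-witness s (~ φ)
          (λ d → not-¬ ▲φ-eq (▲~⇒▲ φ (proj₁ (core-closed d)))) =
        g (invert (subst (Reflects _) φ∉s (truth φ s))) t s⟶t
          (invert (subst (Reflects _)
            (not-injective (trans (sym (MaximalConsistent.~-member (proj₂ t) φ)) ~φ∉t))
            (truth φ t)))

  completeness : ∀ {Γ : Pred (𝓛▲ P) 0ℓ} {φ} → Entails ReflexiveFrames Γ φ → Γ ⊢ φ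
  completeness {Γ} {φ} Γ⊨φ = stable λ ¬d →
    let (s , ⊆s) = lindenbaum {Γ ∪ ｛ ~ φ ｝} λ d →
          ¬d (modusPonens (tautology (~-reductio φ)) (deduction d))
    in Γ⊨φ (canonicalModel s) (λ {t} → ⟶-refl {t}) s
         λ ψ ψ∈ → invert (subst (Reflects _) (⊆s ψ∈) (truth s ψ s))

proposition47 : ExcludedMiddle 0ℓ → WellOrdering →
    (P : Set) (X : Pred (𝓛□ P) 0ℓ) → IsNormal X → K P ⊆ X → X ⊆ T P →
    (Γ : Pred (𝓛▲ P) 0ℓ) (φ : 𝓛▲ P) →
    (Γ ⊢ φ ⇔ Entails AllFrames Γ φ) ×
    (Γ ⊢ φ ⇔ Entails (FramesFor X) Γ φ) ×
    (Γ ⊢ φ ⇔ Entails ReflexiveFrames Γ φ)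
proposition47 em wo P X _ _ X⊆T Γ φ =
  mk⇔ (⊢⇒Entails AllFrames)
    (λ Γ⊨φ → completeness em wo λ M _ → Γ⊨φ M tt) ,
  mk⇔ (⊢⇒Entails (FramesFor X))
    (λ Γ⊨φ → completeness em wo λ M R-refl →
      Γ⊨φ M λ ψ ψ∈X → T-valid (λ {s} → R-refl {s}) ψ (X⊆T ψ∈X)) ,
  mk⇔ (⊢⇒Entails ReflexiveFrames) (completeness em wo)
  where open Classical em
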